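{- Let $F$ be a forest. Then $\mathsf{TS}_3(F)$ is a forest if and only if $F$ is $\{2K_2+K_1,\ D_{2,2,2}+K_1,\ D_{2,4,2}\}$-free.
   Context: Graphs are finite, simple and undirected; a forest is a graph with no cycles (a graph with no nodes counts as a forest). For a graph $G$ and an integer $k\ge 2$, $\mathsf{TS}_k(G)$ is the graph whose nodes are all size-$k$ independent sets of $G$, two nodes $I,J$ being adjacent if there are vertices $u,v$ of $G$ with $I\setminus J=\{u\}$, $J\setminus I=\{v\}$ and $uv\in E(G)$. $+$ denotes disjoint union and $2K_2$ is the disjoint union of two copies of $K_2$. For integers $n,r,s\ge 1$, $D_{r,n,s}$ is the tree obtained from the path $P_n$ on $n$ vertices by attaching $r$ leaves to one end vertex and $s$ leaves to the other end vertex. A graph is $\mathcal{F}$-free if it contains no member of $\mathcal{F}$ as an induced subgraph (up to isomorphism). -}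

module Defs where

open import Data.Empty using (⊥)
open import Data.Fin.Base using (Fin; zero; suc; inject₁; fromℕ)
open import Data.Fin.Subset using (Subset; _∈_; _─_; ⁅_⁆; ∣_∣)
open import Data.Fin.Subset.Properties using (x∈⁅x⁆; x∈⁅y⁆⇒x≡y)
open import Data.List.Base using (List)
open import Data.List.Relation.Unary.All using (All)
open import Data.Nat.Base using (ℕ; suc; _+_; NonZero; NonTrivial)
open import Data.Product.Base using (∃; ∃₂; _×_; _,_)
open import Data.Refinement.Base using (Refinement-syntax; value)
open import Data.Sum.Base using (_⊎_; inj₁; inj₂)
open import Data.Sum.Relation.Binary.Pointwise using (Pointwise; inj₁; inj₂; ⊎-symmetric)
open import Function.Bundles using (_⇔_)
open import Function.Definitions using (Injective)
open import Level using (0ℓ)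
open import Relation.Binary.Construct.Closure.Symmetric as Sym using (SymClosure; fwd; bwd)
open import Relation.Binary.Core using (Rel)
open import Relation.Binary.Definitions using (Symmetric; Irreflexive)
open import Relation.Binary.PropositionalEquality
  using (_≡_; _≢_; refl; sym; subst)
open import Relation.Nullary.Negation using (¬_)

-- Adjacency is not required to be decidable. For finite vertex sets this makes
-- no difference to negative statements such as `Forest` and `Free` below.
record Graph (V : Set) : Set₁ where
  infix 4 _~_
  field
    _~_      : Rel V 0ℓ
    ~-sym    : Symmetric _~_
    ~-irrefl : Irreflexive _≡_ _~_

private variable
  V W : Set
  k n : ℕ

-- A cycle x₀ x₁ … xₗ₊₂ on l + 3 distinct vertices, so of length at least three.
record Cycle (G : Graph V) : Set where
  open Graph G
  field
    l        : ℕ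
    vertex   : Fin (3 + l) → V
    distinct : Injective _≡_ _≡_ vertex
    step     : (i : Fin (2 + l)) → vertex (inject₁ i) ~ vertex (suc i)
    close    : vertex (fromℕ (2 + l)) ~ vertex zero

Forest : Graph V → Set
Forest G = ¬ Cycle G

-- Isomorphisms from H onto an induced subgraph of G.
record InducedEmbedding (H : Graph W) (G : Graph V) : Set where
  open Graph
  field
    map       : W → V
    injective : Injective _≡_ _≡_ map
    adjacency : (x y : W) → _~_ H x y ⇔ _~_ G (map x) (map y)

Free : List (∃ Graph) → Graph V → Set₁
Free ℱ G = All (λ (_ , H) → ¬ InducedEmbedding H G) ℱ

K : (n : ℕ) → Graph (Fin n)
K n = record
  { _~_      = _≢_
  ; ~-sym    = λ x≢y y≡x → x≢y (sym y≡x)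
  ; ~-irrefl = λ x≡y x≢y → x≢y x≡y
  }

infixl 6 _⊕_

_⊕_ : Graph V → Graph W → Graph (V ⊎ W)
G ⊕ H = record
  { _~_      = Pointwise (_~_ G) (_~_ H)
  ; ~-sym    = ⊎-symmetric (~-sym G) (~-sym H)
  ; ~-irrefl = λ { refl (inj₁ x~x) → ~-irrefl G refl x~x
                 ; refl (inj₂ x~x) → ~-irrefl H refl x~x }
  }
  where open Graph

data Next : Rel (Fin n) 0ℓ where
  next : (i : Fin n) → Next (inject₁ i) (suc i)

private
  next-irrefl : {i j : Fin n} → i ≡ j → ¬ Next i j
  next-irrefl i≡j (next i) = inject₁≢suc i i≡j
    where
    inject₁≢suc : (i : Fin n) → inject₁ i ≢ suc i
    inject₁≢suc zero    ()
    inject₁≢suc (suc i) eq = inject₁≢suc i (suc-injective eq)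
      where open import Data.Fin.Properties using (suc-injective)

P : (n : ℕ) → Graph (Fin n)
P n = record
  { _~_      = SymClosure Next
  ; ~-sym    = Sym.symmetric Next
  ; ~-irrefl = λ { i≡j (fwd e) → next-irrefl i≡j e
                 ; i≡j (bwd e) → next-irrefl (sym i≡j) e }
  }

attachLeaves : Graph V → V → (r : ℕ) → Graph (V ⊎ Fin r)
attachLeaves {V} G v r = record
  { _~_      = _∼_
  ; ~-sym    = λ {x} {y} → ∼-sym x y
  ; ~-irrefl = λ { {inj₁ _} refl → ~-irrefl refl ; {inj₂ _} refl () }
  }
  where
  open Graph G

  _∼_ : Rel (V ⊎ Fin r) 0ℓ
  inj₁ x ∼ inj₁ y = x ~ y
  inj₁ x ∼ inj₂ _ = x ≡ v
  inj₂ _ ∼ inj₁ y = y ≡ v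
  inj₂ _ ∼ inj₂ _ = ⊥

  ∼-sym : ∀ x y → x ∼ y → y ∼ x
  ∼-sym (inj₁ _) (inj₁ _) e = ~-sym e
  ∼-sym (inj₁ _) (inj₂ _) e = e
  ∼-sym (inj₂ _) (inj₁ _) e = e

D : (r n s : ℕ) .{{_ : NonZero r}} .{{_ : NonZero n}} .{{_ : NonZero s}} →
    Graph ((Fin n ⊎ Fin r) ⊎ Fin s)
D r (suc m) s =
  attachLeaves (attachLeaves (P (suc m)) zero r) (inj₁ (fromℕ m)) s

Independent : Graph (Fin n) → Subset n → Set
Independent G I = ∀ {u v} → u ∈ I → v ∈ I → ¬ u ~ v
  where open Graph G

-- The proof component of a refinement is irrelevant, so two nodes are
-- propositionally equal exactly when the underlying sets are.
IndependentSet : Graph (Fin n) → ℕ → Set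
IndependentSet {n} G k = [ I ∈ Subset n ∣ ∣ I ∣ ≡ k × Independent G I ]

TS : (k : ℕ) .{{_ : NonTrivial k}} (G : Graph (Fin n)) → Graph (IndependentSet G k)
TS k G = record
  { _~_      = λ I J → Slide (value I) (value J)
  ; ~-sym    = λ (u , v , I─J , J─I , u~v) → v , u , J─I , I─J , ~-sym u~v
  ; ~-irrefl = λ { refl (u , v , I─I≡u , I─I≡v , u~v) →
      ~-irrefl (x∈⁅y⁆⇒x≡y v (subst (u ∈_) I─I≡v (subst (u ∈_) (sym I─I≡u) (x∈⁅x⁆ u)))) u~v }
  }
  where
  open Graph G

  Slide : Rel (Subset _) 0ℓ
  Slide I J = ∃₂ λ u v → I ─ J ≡ ⁅ u ⁆ × J ─ I ≡ ⁅ v ⁆ × u ~ v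

{-# OPTIONS --safe #-}

-- Consider a move of a token from u to v, the others staying at p and q. In a
-- forest without 2K₂ + K₁, the next move along a cycle of TS₃ either turns, the
-- same token going on to some x ≠ u, or follows, another token moving to a
-- neighbour of u: otherwise the two edges used and the third token form
-- 2K₂ + K₁. Two turns in a row again produce 2K₂ + K₁, three follows in a row
-- close a cycle of the forest, turn-follow-turn draws D₂,₂,₂ + K₁ and
-- turn-follow-follow-turn draws D₂,₄,₂. No sequence of moves can therefore go on
-- for long. Conversely each of the three forbidden graphs carries an explicit
-- cyclic tour of three tokens.
module Submission where

open import Defs
open import Data.Empty using (⊥; ⊥-elim)
open import Data.Fin.Base using (Fin; zero; suc; inject₁; fromℕ; toℕ)
open import Data.Fin.Properties
  using (_≟_; all?; any?; sequence; suc-injective; toℕ-injective; toℕ-inject₁; toℕ-fromℕ; toℕ<n)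
open import Data.Fin.Relation.Unary.Top using (view; ‵fromℕ; ‵inject₁; view-fromℕ; view-inject₁)
open import Data.Fin.Subset
  using (Subset; _∈_; _∉_; _⊆_; _─_; _∪_; ⁅_⁆; ∣_∣; inside; outside) renaming (⊥ to ∅)
open import Data.Fin.Subset.Properties
  using ( x∈⁅x⁆; x∈⁅y⁆⇒x≡y; x∈p∪q⁻; x∈p∪q⁺; ∉⊥; ∣⊥∣≡0; ⊆-antisym; _∈?_; x∈p∧x∉q⇒x∈p─q; p─q⊆p
        ; ∪-identityˡ; ∪-assoc; ∪-comm)
open import Data.Irrelevant using () renaming ([_] to ⟨_⟩)
open import Data.List.Base using (_∷_; [])
open import Data.List.Relation.Unary.All using (_∷_; [])
open import Data.Nat.Base using (ℕ; zero; suc; _+_; NonZero; NonTrivial)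
import Data.Nat.Properties as ℕ
open import Data.Product.Base using (∃; ∃₂; _×_; _,_; proj₁; proj₂; -,_)
open import Data.Refinement.Base using (value) renaming (_,_ to _⊣_)
open import Data.Refinement.Properties using (value-injective)
open import Data.Sum.Base as Sum using (_⊎_; inj₁; inj₂; [_,_])
open import Data.Sum.Properties using () renaming (≡-dec to ⊎-≡-dec)
open import Data.Sum.Relation.Binary.Pointwise using (inj₁; inj₂; ⊎-decidable)
open import Data.Vec.Base using (Vec; []; _∷_; lookup; here; there)
import Data.Vec.Functional as Fun
open Fun using (Vector)
open import Data.Vec.Membership.Propositional using () renaming (_∈_ to _∈ᵥ_)
open import Data.Vec.Relation.Unary.All as All using (All; []; _∷_)
open import Data.Vec.Relation.Unary.AllPairs using ([]; _∷_)
open import Data.Vec.Relation.Unary.Any using (here; there)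
open import Data.Vec.Relation.Unary.Unique.Propositional using (Unique)
open import Data.Vec.Relation.Unary.Unique.Propositional.Properties using (lookup-injective)
open import Effect.Monad using (RawMonad)
open import Function.Base using (_∘_; id)
open import Function.Bundles using (_⇔_; mk⇔; Equivalence)
open Equivalence using (to; from)
open import Function.Definitions using (Injective)
open import Level using (0ℓ)
open import Relation.Binary.Construct.Closure.ReflexiveTransitive as Star using (Star; ε; _◅_; _◅◅_)
open import Relation.Binary.Construct.Closure.Symmetric as Sym using (SymClosure; fwd; bwd)
open import Relation.Binary.Core using (Rel)
open import Relation.Binary.Definitions using (Decidable; DecidableEquality)
open import Relation.Binary.PropositionalEquality
  using (_≡_; _≢_; refl; sym; trans; cong; subst; subst₂; ≢-sym)
open import Relation.Nullary.Decidable
  using ( Dec; yes; no; ¬?; map′; _×-dec_; _→-dec_; _⊎-dec_; from-yes; toSum; recompute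
        ; decidable-stable; ¬¬-excluded-middle)
open import Relation.Nullary.Negation using (¬_; contradiction; ¬¬-Monad)
open import Relation.Nullary.Recomputable using (⊥-recompute)

private variable
  V W : Set
  k l n : ℕ

-- Token configurations

-- The argument follows labelled tokens, while the nodes of `TS k F` are bare sets; this map forgets
-- the labels.
⟦_⟧ : Vector (Fin n) k → Subset n
⟦_⟧ {k = zero}  t = ∅
⟦_⟧ {k = suc k} t = ⁅ t zero ⁆ ∪ ⟦ t ∘ suc ⟧

∈⟦⟧⁺ : (t : Vector (Fin n) k) (i : Fin k) → t i ∈ ⟦ t ⟧
∈⟦⟧⁺ t zero    = x∈p∪q⁺ (inj₁ (x∈⁅x⁆ _))
∈⟦⟧⁺ t (suc i) = x∈p∪q⁺ (inj₂ (∈⟦⟧⁺ (t ∘ suc) i))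

∈⟦⟧⁻ : (t : Vector (Fin n) k) {x : Fin n} → x ∈ ⟦ t ⟧ → ∃ λ i → x ≡ t i
∈⟦⟧⁻ {k = zero}  t x∈ = contradiction x∈ ∉⊥
∈⟦⟧⁻ {k = suc k} t x∈ with x∈p∪q⁻ _ _ x∈
... | inj₁ x∈ = zero , x∈⁅y⁆⇒x≡y _ x∈
... | inj₂ x∈ with i , x≡ ← ∈⟦⟧⁻ (t ∘ suc) x∈ = suc i , x≡

x∉p⇒∣⁅x⁆∪p∣≡1+∣p∣ : {x : Fin n} (p : Subset n) → x ∉ p → ∣ ⁅ x ⁆ ∪ p ∣ ≡ suc ∣ p ∣
x∉p⇒∣⁅x⁆∪p∣≡1+∣p∣ {x = zero}  (inside  ∷ p) x∉ = contradiction here x∉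
x∉p⇒∣⁅x⁆∪p∣≡1+∣p∣ {x = zero}  (outside ∷ p) x∉ = cong (suc ∘ ∣_∣) (∪-identityˡ p)
x∉p⇒∣⁅x⁆∪p∣≡1+∣p∣ {x = suc x} (inside  ∷ p) x∉ = cong suc (x∉p⇒∣⁅x⁆∪p∣≡1+∣p∣ p (x∉ ∘ there))
x∉p⇒∣⁅x⁆∪p∣≡1+∣p∣ {x = suc x} (outside ∷ p) x∉ = x∉p⇒∣⁅x⁆∪p∣≡1+∣p∣ p (x∉ ∘ there)

∣⟦⟧∣ : (t : Vector (Fin n) k) → Injective _≡_ _≡_ t → ∣ ⟦ t ⟧ ∣ ≡ k
∣⟦⟧∣ {n} {zero}  t inj = ∣⊥∣≡0 n
∣⟦⟧∣ {n} {suc k} t inj = trans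
  (x∉p⇒∣⁅x⁆∪p∣≡1+∣p∣ _ λ 0∈ → case-0 (∈⟦⟧⁻ (t ∘ suc) 0∈))
  (cong suc (∣⟦⟧∣ (t ∘ suc) (suc-injective ∘ inj)))
  where
  case-0 : ¬ ∃ λ i → t zero ≡ t (suc i)
  case-0 (i , eq) with () ← inj eq

⟦suc⟧ : (t : Vector (Fin n) k) → ⟦ suc ∘ t ⟧ ≡ outside ∷ ⟦ t ⟧
⟦suc⟧ {k = zero}  t = refl
⟦suc⟧ {k = suc k} t = cong (⁅ suc (t zero) ⁆ ∪_) (⟦suc⟧ (t ∘ suc))

enumerate : (p : Subset n) → ∣ p ∣ ≡ k → ∃ λ (t : Vector (Fin n) k) → Injective _≡_ _≡_ t × p ≡ ⟦ t ⟧
enumerate []            refl = (λ ()) , (λ { {()} }) , refl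
enumerate (outside ∷ p) eq   with t , inj , p≡ ← enumerate p eq =
  suc ∘ t , inj ∘ suc-injective , trans (cong (outside ∷_) p≡) (sym (⟦suc⟧ t))
enumerate (inside  ∷ p) refl with t , inj , p≡ ← enumerate p refl =
  zero Fun.∷ suc ∘ t , (λ {i} {j} → inj′ i j) ,
  trans (cong (inside ∷_) (trans p≡ (sym (∪-identityˡ ⟦ t ⟧)))) (cong (⁅ zero ⁆ ∪_) (sym (⟦suc⟧ t)))
  where
  inj′ : ∀ i j → (zero Fun.∷ suc ∘ t) i ≡ (zero Fun.∷ suc ∘ t) j → i ≡ j
  inj′ zero    zero    _  = refl
  inj′ zero    (suc j) ()
  inj′ (suc i) zero    ()
  inj′ (suc i) (suc j) eq = cong suc (inj (suc-injective eq))

x∈p─q⇒x∉q : {x : Fin n} (p q : Subset n) → x ∈ p ─ q → x ∉ q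
x∈p─q⇒x∉q (_ ∷ p) (_       ∷ q) (there x∈) (there x∈q) = x∈p─q⇒x∉q p q x∈ x∈q

pair : V → V → Vector V 2
pair x y = x Fun.∷ y Fun.∷ Fun.[]

pair-injective : {x y : V} → x ≢ y → Injective _≡_ _≡_ (pair x y)
pair-injective x≢y {zero}     {zero}     _   = refl
pair-injective x≢y {zero}     {suc zero} x≡y = contradiction x≡y x≢y
pair-injective x≢y {suc zero} {zero}     y≡x = contradiction (sym y≡x) x≢y
pair-injective x≢y {suc zero} {suc zero} _   = refl

triple : V → V → V → Vector V 3
triple x y z = x Fun.∷ pair y z

⟪_,_,_⟫ : (a b c : Fin n) → Subset n
⟪ a , b , c ⟫ = ⟦ triple a b c ⟧

∪-left-commute : (p q r : Subset n) → p ∪ (q ∪ r) ≡ q ∪ (p ∪ r)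
∪-left-commute p q r = trans (sym (∪-assoc p q r)) (trans (cong (_∪ r) (∪-comm p q)) (∪-assoc q p r))

⟪⟫-swap₁₂ : (a b c : Fin n) → ⟪ a , b , c ⟫ ≡ ⟪ b , a , c ⟫
⟪⟫-swap₁₂ a b c = ∪-left-commute ⁅ a ⁆ ⁅ b ⁆ _

⟪⟫-swap₂₃ : (a b c : Fin n) → ⟪ a , b , c ⟫ ≡ ⟪ a , c , b ⟫
⟪⟫-swap₂₃ a b c = cong (⁅ a ⁆ ∪_) (∪-left-commute ⁅ b ⁆ ⁅ c ⁆ _)

-- The two differences determine `J`: outside `I` it has only `v`, it lacks `u`, and a `t i` missing
-- from `J` would lie in `I ─ J`, forcing `u ≡ t i`.
slide-replaces : {t : Vector (Fin n) k} {J : Subset n} {u v : Fin n} →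
  let I = ⟦ u Fun.∷ t ⟧ in
  (∀ i → u ≢ t i) → I ─ J ≡ ⁅ u ⁆ → J ─ I ≡ ⁅ v ⁆ → J ≡ ⟦ v Fun.∷ t ⟧
slide-replaces {t = t} {J} {u} {v} u∉t I─J J─I = ⊆-antisym J⊆ ⊆J
  where
  I = ⟦ u Fun.∷ t ⟧

  J⊆ : J ⊆ ⟦ v Fun.∷ t ⟧
  J⊆ {x} x∈J with x ∈? I
  ... | no x∉I with refl ← x∈⁅y⁆⇒x≡y v (subst (x ∈_) J─I (x∈p∧x∉q⇒x∈p─q x∈J x∉I)) = ∈⟦⟧⁺ (v Fun.∷ t) zero
  ... | yes x∈I with ∈⟦⟧⁻ (u Fun.∷ t) x∈I
  ...   | suc i , refl = ∈⟦⟧⁺ (v Fun.∷ t) (suc i)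
  ...   | zero  , refl = contradiction x∈J (x∈p─q⇒x∉q I J (subst (x ∈_) (sym I─J) (x∈⁅x⁆ x)))

  ⊆J : ⟦ v Fun.∷ t ⟧ ⊆ J
  ⊆J {x} x∈ with ∈⟦⟧⁻ (v Fun.∷ t) x∈
  ... | zero  , refl = p─q⊆p J I (subst (x ∈_) (sym J─I) (x∈⁅x⁆ x))
  ... | suc i , refl = decidable-stable (x ∈? J) λ x∉J → u∉t i
    (sym (x∈⁅y⁆⇒x≡y u (subst (x ∈_) I─J (x∈p∧x∉q⇒x∈p─q (∈⟦⟧⁺ (u Fun.∷ t) (suc i)) x∉J))))

-- The proof stored in a node is irrelevant, but a contradiction, and likewise a decidable equation,
-- can be recovered from it.
TS-independent : (G : Graph (Fin n)) (I : IndependentSet G k) → Independent G (value I)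
TS-independent G (_ ⊣ ⟨ pf ⟩) u∈ v∈ u~v = ⊥-recompute (proj₂ pf u∈ v∈ u~v)

TS-size : (G : Graph (Fin n)) (I : IndependentSet G k) → ∣ value I ∣ ≡ k
TS-size {k = k} G (I ⊣ ⟨ pf ⟩) = recompute (∣ I ∣ ℕ.≟ k) (proj₁ pf)

-- Forests

module _ {V : Set} (R : Rel V 0ℓ) where

  -- Simple paths. The indices are the last vertex, the first vertex and the vector of all vertices,
  -- whose `lookup` later serves as the `vertex` function of a `Cycle`.
  data Path (z : V) : V → Vec V (suc k) → Set where
    [-]  : Path z z (z ∷ [])
    cons : ∀ {x y} {ys : Vec V (suc k)} →
           R x y → All (x ≢_) ys → Path z y ys → Path z x (x ∷ ys)

module _ {V : Set} {R : Rel V 0ℓ} where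

  path-unique : ∀ {x z} {xs : Vec V (suc k)} → Path R z x xs → Unique xs
  path-unique [-]           = [] ∷ []
  path-unique (cons _ x∉ p) = x∉ ∷ path-unique p

  path-last : ∀ {x z} {xs : Vec V (suc k)} → Path R z x xs → lookup xs (fromℕ k) ≡ z
  path-last [-]          = refl
  path-last (cons _ _ p) = path-last p

  path-step : ∀ {x z} {xs : Vec V (suc k)} → Path R z x xs →
              (i : Fin k) → R (lookup xs (inject₁ i)) (lookup xs (suc i))
  path-step (cons r _ [-])          zero    = r
  path-step (cons r _ (cons _ _ _)) zero    = r
  path-step (cons _ _ p)            (suc i) = path-step p i

  path-avoids : ∀ {w x z} {xs : Vec V (suc k)} → (∀ {a b} → R a b → w ≢ b) → w ≢ x →
                Path R z x xs → All (w ≢_) xs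
  path-avoids avoids w≢x [-]          = w≢x ∷ []
  path-avoids avoids w≢x (cons r _ p) = w≢x ∷ path-avoids avoids (avoids r) p

  path-suffix : ∀ {x y z} {ys : Vec V (suc k)} → x ∈ᵥ ys → Path R z y ys →
                ∃₂ λ l (xs : Vec V (suc l)) → Path R z x xs
  path-suffix (here refl) [-]            = -, -, [-]
  path-suffix (here refl) p@(cons _ _ _) = -, -, p
  path-suffix (there x∈)  (cons _ _ p)   = path-suffix x∈ p

  module _ (_≟_ : DecidableEquality V) where

    -- If `x` recurs on the simple path obtained from the rest of the walk, the suffix from that
    -- occurrence is already a simple path from `x`.
    eraseLoops : ∀ {x z} → Star R x z → ∃₂ λ l (xs : Vec V (suc l)) → Path R z x xs
    eraseLoops ε = -, -, [-]
    eraseLoops (_◅_ {i = x} r w) with eraseLoops w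
    ... | _ , ys , p with All.decide (Sum.swap ∘ toSum ∘ (x ≟_)) ys
    ...   | inj₁ x∉ = -, -, cons r x∉ p
    ...   | inj₂ x∈ = path-suffix x∈ p

-- Adjacency in path graphs, and connectedness

Next⇒toℕ : {i j : Fin k} → Next i j → suc (toℕ i) ≡ toℕ j
Next⇒toℕ (next i) = cong suc (toℕ-inject₁ i)

toℕ⇒Next : (i j : Fin k) → suc (toℕ i) ≡ toℕ j → Next i j
toℕ⇒Next i (suc j) eq
  rewrite toℕ-injective {i = i} {inject₁ j} (trans (ℕ.suc-injective eq) (sym (toℕ-inject₁ j))) = next j

P-suc : {i j : Fin k} → SymClosure Next i j ⇔ SymClosure Next (suc i) (suc j)
P-suc = mk⇔ (Sym.gmap suc λ { (next i) → next (suc i) })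
            (λ { (fwd e) → fwd (pred e) ; (bwd e) → bwd (pred e) })
  where
  pred : {i j : Fin k} → Next (suc i) (suc j) → Next i j
  pred e = toℕ⇒Next _ _ (ℕ.suc-injective (Next⇒toℕ e))

-- Stated through `toℕ` because `Fin k` has no `zero` for a general `k`.
zero-neighbour : {j : Fin k} → SymClosure Next zero (suc j) → toℕ j ≡ 0
zero-neighbour (fwd e) = sym (ℕ.suc-injective (Next⇒toℕ e))
zero-neighbour (bwd e) with () ← Next⇒toℕ e

last-neighbour : (j : Fin (2 + k)) → SymClosure Next (fromℕ (suc k)) j → j ≡ inject₁ (fromℕ k)
last-neighbour {k} j (fwd e) = contradiction (ℕ.≤-reflexive (trans (cong suc (sym (toℕ-fromℕ (suc k)))) (Next⇒toℕ e)))
  (ℕ.<⇒≱ (toℕ<n j))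
last-neighbour {k} j (bwd e) = toℕ-injective
  (trans (ℕ.suc-injective (trans (Next⇒toℕ e) (cong suc (toℕ-fromℕ k))))
         (sym (trans (toℕ-inject₁ (fromℕ k)) (toℕ-fromℕ k))))

Connected : Graph V → Set
Connected G = ∀ x y → Star (Graph._~_ G) x y

P-connected : ∀ n → Connected (P (suc n))
P-connected n i j = Star.reverse (Sym.symmetric Next) (from-zero n i) ◅◅ from-zero n j
  where
  from-zero : ∀ n (j : Fin (suc n)) → Star (SymClosure Next) zero j
  from-zero n       zero    = ε
  from-zero (suc n) (suc j) = fwd (next zero) ◅ Star.gmap suc (to P-suc) (from-zero n j)

attachLeaves-connected : ∀ {G : Graph V} v r → Connected G → Connected (attachLeaves G v r)
attachLeaves-connected {G = G} v r conn x y =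
  Star.reverse (λ {a} {b} → Graph.~-sym H {a} {b}) (from-v x) ◅◅ from-v y
  where
  H = attachLeaves G v r

  from-v : ∀ x → Star (Graph._~_ H) (inj₁ v) x
  from-v (inj₁ x) = Star.gmap inj₁ id (conn v x)
  from-v (inj₂ i) = refl ◅ ε

-- Induced embeddings, in general and into a forest

module _ {n : ℕ} (F : Graph (Fin n)) where
  open Graph F

  infix 4 _#_

  -- The relation between two tokens that may stand together in one independent set.
  _#_ : Rel (Fin n) 0ℓ
  a # b = a ≢ b × ¬ a ~ b

  #-sym : ∀ {a b} → a # b → b # a
  #-sym (a≢b , a≁b) = (λ b≡a → a≢b (sym b≡a)) , λ b~a → a≁b (~-sym b~a)

  ~⇒≢ : ∀ {a b} → a ~ b → a ≢ b
  ~⇒≢ a~b a≡b = ~-irrefl a≡b a~b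

  #⇒≢ : ∀ {a b c} → a # b → c ~ b → a ≢ c
  #⇒≢ (_ , a≁b) c~b refl = a≁b c~b

  singleton-embedding : (H : Graph (Fin 1)) → Fin n → InducedEmbedding H F
  singleton-embedding H a = record
    { map       = λ _ → a
    ; injective = λ { {zero} {zero} _ → refl }
    ; adjacency = λ { zero zero → mk⇔ (λ e → contradiction e (Graph.~-irrefl H refl))
                                      (λ e → contradiction e (~-irrefl refl)) }
    }

  K₂-embedding : ∀ {a b} → a ~ b → InducedEmbedding (K 2) F
  K₂-embedding {a} {b} a~b = record
    { map       = pair a b
    ; injective = pair-injective (~⇒≢ a~b)
    ; adjacency = λ
      { zero       zero       → mk⇔ (λ 0≢0 → contradiction refl 0≢0) (λ a~a _ → ~-irrefl refl a~a)
      ; zero       (suc zero) → mk⇔ (λ _ → a~b) (λ _ ())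
      ; (suc zero) zero       → mk⇔ (λ _ → ~-sym a~b) (λ _ ())
      ; (suc zero) (suc zero) → mk⇔ (λ 1≢1 → contradiction refl 1≢1) (λ b~b _ → ~-irrefl refl b~b)
      }
    }

  module _ {G : Graph V} {H : Graph W} (f : InducedEmbedding G F) (g : InducedEmbedding H F) where
    private
      module f = InducedEmbedding f
      module g = InducedEmbedding g

    ⊕-embedding : (∀ x y → f.map x # g.map y) → InducedEmbedding (G ⊕ H) F
    ⊕-embedding f#g = record
      { map       = map
      ; injective = λ {x} {y} → injective x y
      ; adjacency = adjacency
      }
      where
      map : V ⊎ W → Fin n
      map = [ f.map , g.map ]

      injective : ∀ x y → map x ≡ map y → x ≡ y
      injective (inj₁ x) (inj₁ y) eq = cong inj₁ (f.injective eq)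
      injective (inj₁ x) (inj₂ y) eq = contradiction eq (proj₁ (f#g x y))
      injective (inj₂ x) (inj₁ y) eq = contradiction (sym eq) (proj₁ (f#g y x))
      injective (inj₂ x) (inj₂ y) eq = cong inj₂ (g.injective eq)

      adjacency : ∀ x y → Graph._~_ (G ⊕ H) x y ⇔ map x ~ map y
      adjacency (inj₁ x) (inj₁ y) = mk⇔ (λ { (inj₁ e) → to (f.adjacency x y) e })
                                        (λ e → inj₁ (from (f.adjacency x y) e))
      adjacency (inj₁ x) (inj₂ y) = mk⇔ (λ ()) (λ e → contradiction e (proj₂ (f#g x y)))
      adjacency (inj₂ x) (inj₁ y) = mk⇔ (λ ()) (λ e → contradiction (~-sym e) (proj₂ (f#g y x)))
      adjacency (inj₂ x) (inj₂ y) = mk⇔ (λ { (inj₂ e) → to (g.adjacency x y) e })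
                                        (λ e → inj₂ (from (g.adjacency x y) e))

  module _ (forest : Forest F) where

    AvoidingStep : Fin n → Rel (Fin n) 0ℓ
    AvoidingStep w a b = a ~ b × b ≢ w

    -- Otherwise erasing loops leaves a simple path from `a` to `b` that misses `w`, and `w` closes
    -- it to a cycle.
    no-detour : ∀ {w a b} → w ~ a → w ~ b → Star (AvoidingStep w) a b → a ≡ b
    no-detour {w} {a} {b} w~a w~b walk with eraseLoops _≟_ walk
    ... | _ , _  , [-]            = refl
    ... | _ , xs , p@(cons _ _ _) = contradiction cycle forest
      where
      unique : Unique (w ∷ xs)
      unique = path-avoids (λ (_ , b≢w) w≡b → b≢w (sym w≡b)) (~⇒≢ w~a) p ∷ path-unique p

      step : ∀ i → lookup (w ∷ xs) (inject₁ i) ~ lookup (w ∷ xs) (suc i)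
      step zero with cons _ _ _ ← p = w~a
      step (suc i) = proj₁ (path-step p i)

      cycle : Cycle F
      cycle = record
        { vertex   = lookup (w ∷ xs)
        ; distinct = λ {i} {j} → lookup-injective unique i j
        ; step     = step
        ; close    = subst (_~ w) (sym (path-last p)) (~-sym w~b)
        }

    -- An edge from `a` to `c` would make the walk a detour around `a` between two of its
    -- neighbours.
    #-path : ∀ {a b c} → a ~ b → Star (AvoidingStep a) b c → b ≢ c → a ≢ c → a # c
    #-path a~b walk b≢c a≢c = a≢c , λ a~c → b≢c (no-detour a~b a~c walk)

    module _ {G : Graph V} (connected : Connected G) (f : InducedEmbedding G F) where
      open InducedEmbedding f

      module _ {a v} (a~v : a ~ map v) (a∉N : ∀ x → Graph._~_ G v x → a ≢ map x) where

        -- If `a` were `map x`, then `x` would be a neighbour of `v`, as the embedding is induced;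
        -- so only neighbours of `v` have to be excluded.
        leaf-fresh : ∀ x → a ≢ map x
        leaf-fresh x a≡x = a∉N x (from (adjacency v x) (~-sym (subst (_~ map v) a≡x a~v))) a≡x

        -- Two edges from `a` into the connected image, which misses `a`, would be joined by a
        -- detour around `a`.
        leaf-adjacency : ∀ {x} → a ~ map x → x ≡ v
        leaf-adjacency {x} a~x = injective (no-detour a~x a~v
          (Star.gmap map (λ {x} {y} x~y → to (adjacency x y) x~y , λ y≡a → leaf-fresh y (sym y≡a)) (connected x v)))

    -- Only the second vertex of the path has to be avoided; with `toℕ` the condition is vacuous on
    -- a path with one vertex.
    P-cons : ∀ {k a} (f : InducedEmbedding (P (suc k)) F) → a ~ InducedEmbedding.map f zero →
             (∀ j → toℕ j ≡ 1 → a ≢ InducedEmbedding.map f j) → InducedEmbedding (P (2 + k)) F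
    P-cons {k} {a} f a~0 a≢1 = record
      { map       = a Fun.∷ map
      ; injective = λ {i} {j} → inj i j
      ; adjacency = adj
      }
      where
      open InducedEmbedding f

      a∉N : ∀ j → SymClosure Next zero j → a ≢ map j
      a∉N zero    e = contradiction e (Graph.~-irrefl (P _) refl)
      a∉N (suc j) e = a≢1 (suc j) (cong suc (zero-neighbour e))

      fresh = leaf-fresh (P-connected k) f a~0 a∉N

      inj : ∀ i j → (a Fun.∷ map) i ≡ (a Fun.∷ map) j → i ≡ j
      inj zero    zero    _  = refl
      inj zero    (suc j) eq = contradiction eq (fresh j)
      inj (suc i) zero    eq = contradiction (sym eq) (fresh i)
      inj (suc i) (suc j) eq = cong suc (injective eq)

      0→ : ∀ j → SymClosure Next zero (suc j) → a ~ map j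
      0→ j e rewrite toℕ-injective {i = j} {zero} (zero-neighbour e) = a~0

      →0 : ∀ j → a ~ map j → SymClosure Next zero (suc j)
      →0 j a~j rewrite leaf-adjacency (P-connected k) f a~0 a∉N a~j = fwd (next zero)

      adj : ∀ i j → SymClosure Next i j ⇔ (a Fun.∷ map) i ~ (a Fun.∷ map) j
      adj zero    zero    = mk⇔ (λ e → contradiction e (Graph.~-irrefl (P _) refl))
                                (λ e → contradiction e (~-irrefl refl))
      adj zero    (suc j) = mk⇔ (0→ j) (→0 j)
      adj (suc i) zero    = mk⇔ (λ e → ~-sym (0→ i (Sym.symmetric Next e)))
                                (λ e → Sym.symmetric Next (→0 i (~-sym e)))
      adj (suc i) (suc j) = mk⇔ (λ e → to (adjacency i j) (from P-suc e))
                                (λ e → to P-suc (from (adjacency i j) e))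

    module _ {G : Graph V} (connected : Connected G) (f : InducedEmbedding G F) where
      open InducedEmbedding f

      attachLeaves-embedding : ∀ {v r} (leaf : Fin r → Fin n) → Injective _≡_ _≡_ leaf →
        (∀ i → leaf i ~ map v) → (∀ i x → Graph._~_ G v x → leaf i ≢ map x) →
        InducedEmbedding (attachLeaves G v r) F
      attachLeaves-embedding {v} {r} leaf leaf-injective leaf~v leaf∉N = record
        { map       = map⁺
        ; injective = λ {x} {y} → inj x y
        ; adjacency = adj
        }
        where
        map⁺ : V ⊎ Fin r → Fin n
        map⁺ = [ map , leaf ]

        fresh : ∀ i x → leaf i ≢ map x
        fresh i = leaf-fresh connected f (leaf~v i) (leaf∉N i)

        inj : ∀ x y → map⁺ x ≡ map⁺ y → x ≡ y
        inj (inj₁ x) (inj₁ y) eq = cong inj₁ (injective eq)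
        inj (inj₁ x) (inj₂ i) eq = contradiction (sym eq) (fresh i x)
        inj (inj₂ i) (inj₁ x) eq = contradiction eq (fresh i x)
        inj (inj₂ i) (inj₂ j) eq = cong inj₂ (leaf-injective eq)

        leaf~ : ∀ i x → x ≡ v ⇔ leaf i ~ map x
        leaf~ i x = mk⇔ (λ { refl → leaf~v i }) (leaf-adjacency connected f (leaf~v i) (leaf∉N i))

        leaf≁leaf : ∀ i j → ¬ leaf i ~ leaf j
        -- Two adjacent leaves would form a triangle with `map v`.
        leaf≁leaf i j i~j = ~⇒≢ (leaf~v j) (no-detour i~j (leaf~v i) ((leaf~v j , λ v≡i → fresh i v (sym v≡i)) ◅ ε))

        adj : ∀ x y → Graph._~_ (attachLeaves G v r) x y ⇔ map⁺ x ~ map⁺ y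
        adj (inj₁ x) (inj₁ y) = adjacency x y
        adj (inj₁ x) (inj₂ i) = mk⇔ (λ e → ~-sym (to (leaf~ i x) e))
                                    (λ e → from (leaf~ i x) (~-sym e))
        adj (inj₂ i) (inj₁ x) = leaf~ i x
        adj (inj₂ i) (inj₂ j) = mk⇔ (λ ()) (leaf≁leaf i j)

    module _ {k : ℕ} (f : InducedEmbedding (P (2 + k)) F) where
      open InducedEmbedding f

      -- Each leaf only has to avoid the path vertex next to its own end: freshness comes from the
      -- embedding being induced, the absence of further edges from acyclicity.
      D-embedding : ∀ {r s} .{{_ : NonZero r}} .{{_ : NonZero s}} (a : Fin r → Fin n) (b : Fin s → Fin n) →
        Injective _≡_ _≡_ a → Injective _≡_ _≡_ b →
        (∀ i → a i ~ map zero) → (∀ i → a i ≢ map (suc zero)) →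
        (∀ i → b i ~ map (fromℕ (suc k))) → (∀ i → b i ≢ map (inject₁ (fromℕ k))) →
        InducedEmbedding (D r (2 + k) s) F
      D-embedding a b a-inj b-inj a~ a≢ b~ b≢ =
        attachLeaves-embedding (attachLeaves-connected zero _ (P-connected _))
          (attachLeaves-embedding (P-connected _) f a a-inj a~ a∉N) b b-inj b~ b∉N
        where
        a∉N : ∀ i j → SymClosure Next zero j → a i ≢ map j
        a∉N i zero    e = contradiction e (Graph.~-irrefl (P _) refl)
        a∉N i (suc j) e rewrite toℕ-injective {i = j} {zero} (zero-neighbour e) = a≢ i

        b∉N : ∀ i x → Graph._~_ (attachLeaves (P (2 + k)) zero _) (inj₁ (fromℕ (suc k))) x → b i ≢ [ map , a ] x
        b∉N i (inj₁ j) e rewrite last-neighbour j e = b≢ i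
        -- With at least two path vertices the last one is not `zero`, so the leaves at `zero` are
        -- not its neighbours.
        b∉N i (inj₂ j) ()

    -- Moves of a token in a forest, and the patterns they cannot form

    -- A token moves from u to v while the other two stay at p and q.
    record Hop (u v p q : Fin n) : Set where
      field
        u~v : u ~ v
        u#p : u # p
        u#q : u # q
        v#p : v # p
        v#q : v # q
        p#q : p # q

    hop-swap : ∀ {u v p q} → Hop u v p q → Hop u v q p
    hop-swap h = record { u~v = u~v ; u#p = u#q ; u#q = u#p ; v#p = v#q ; v#q = v#p ; p#q = #-sym p#q }
      where open Hop h

    -- A walk in a forest that never turns back is an induced path. This and the next two lemmas say
    -- so for the ends of two, three and four edges.
    path₂ : ∀ {a b c} → a ~ b → b ~ c → a ≢ c → a # c
    path₂ a~b b~c a≢c = #-path a~b ((b~c , ≢-sym a≢c) ◅ ε) (~⇒≢ b~c) a≢c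

    path₃ : ∀ {a b c d} → a ~ b → b ~ c → c ~ d → a ≢ c → b ≢ d → a # d
    path₃ a~b b~c c~d a≢c b≢d =
      #-path a~b ((b~c , ≢-sym a≢c) ◅ (c~d , d≢a) ◅ ε) b≢d (≢-sym d≢a)
      -- `a` is adjacent to `b`, but `d` is not.
      where d≢a = #⇒≢ (#-sym (path₂ b~c c~d b≢d)) a~b

    path₄ : ∀ {a b c d e} → a ~ b → b ~ c → c ~ d → d ~ e → a ≢ c → b ≢ d → c ≢ e → a # e
    path₄ a~b b~c c~d d~e a≢c b≢d c≢e =
      #-path a~b ((b~c , ≢-sym a≢c) ◅ (c~d , ≢-sym (proj₁ (path₃ a~b b~c c~d a≢c b≢d))) ◅ (d~e , e≢a) ◅ ε)
        (proj₁ b#e) (≢-sym e≢a)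
      where
      b#e = path₃ b~c c~d d~e b≢d c≢e
      e≢a = #⇒≢ (#-sym b#e) a~b

    -- The walk `x`, `p`, `p′`, `u` avoids `v` and joins two neighbours of `v`; so `x ≡ u`, and `u`
    -- would be adjacent to `p`.
    no-return-after-follow : ∀ {u v p q p′ x} → Hop u v p q → Hop p p′ v q → p′ ~ u →
                             Hop v x p′ q → x ~ p → ⊥
    no-return-after-follow m₀ m₁ p′~u m₂ x~p = proj₂ (Hop.u#p m₀) (subst (_~ _) x≡u x~p)
      where
      x≡u = no-detour (Hop.u~v m₂) (~-sym (Hop.u~v m₀))
        ((x~p , proj₁ (Hop.u#p m₁)) ◅ (Hop.u~v m₁ , proj₁ (Hop.v#p m₁)) ◅ (p′~u , ~⇒≢ (Hop.u~v m₀)) ◅ ε)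

    -- The same with the longer detour `x`, `q`, `q′`, `p`, `p′`, `u` around `v`; here `x ≡ u`
    -- contradicts `u # q`.
    no-return-after-follows : ∀ {u v p q p′ q′ x} → Hop u v p q → Hop p p′ v q → p′ ~ u →
                              Hop q q′ p′ v → q′ ~ p → Hop v x q′ p′ → x ~ q → ⊥
    no-return-after-follows m₀ m₁ p′~u m₂ q′~p m₃ x~q = proj₂ (Hop.u#q m₀) (subst (_~ _) x≡u x~q)
      where
      x≡u = no-detour (Hop.u~v m₃) (~-sym (Hop.u~v m₀))
        ((x~q , proj₁ (Hop.u#q m₂)) ◅ (Hop.u~v m₂ , proj₁ (Hop.v#q m₂)) ◅ (q′~p , proj₁ (Hop.u#p m₁))
         ◅ (Hop.u~v m₁ , proj₁ (Hop.v#p m₁)) ◅ (p′~u , ~⇒≢ (Hop.u~v m₀)) ◅ ε)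

    module _ (no-2K₂+K₁ : ¬ InducedEmbedding (K 2 ⊕ K 2 ⊕ K 1) F) where

      no-two-edges-and-vertex : ∀ {a b c d e} → a ~ b → c ~ d →
        a # c → a # d → b # c → b # d → a # e → b # e → c # e → d # e → ⊥
      no-two-edges-and-vertex {e = e} a~b c~d a#c a#d b#c b#d a#e b#e c#e d#e = no-2K₂+K₁
        (⊕-embedding (⊕-embedding (K₂-embedding a~b) (K₂-embedding c~d)
          (λ { zero zero → a#c ; zero (suc zero) → a#d ; (suc zero) zero → b#c ; (suc zero) (suc zero) → b#d }))
          (singleton-embedding (K 1) e)
          (λ { (inj₁ zero) _ → a#e ; (inj₁ (suc zero)) _ → b#e ; (inj₂ zero) _ → c#e ; (inj₂ (suc zero)) _ → d#e }))

      -- The edges `u v` and `p p′` and the vertex `q` span 2K₂ + K₁ unless `p′` is adjacent to `u`,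
      -- the only adjacency that the two hops leave open.
      follows : Decidable _~_ → ∀ {u v p q p′} → Hop u v p q → Hop p p′ v q → p′ ~ u
      follows _~?_ {u} {v} {p} {q} {p′} m₀ m₁ = decidable-stable (p′ ~? u) λ p′≁u →
        no-two-edges-and-vertex (Hop.u~v m₀) (Hop.u~v m₁)
          (Hop.u#p m₀) (#⇒≢ (Hop.u#p m₀) (~-sym (Hop.u~v m₁)) , λ u~p′ → p′≁u (~-sym u~p′))
          (Hop.v#p m₀) (#-sym (Hop.v#p m₁))
          (Hop.u#q m₀) (Hop.v#q m₀) (Hop.p#q m₀) (Hop.v#q m₁)

      -- The first and the last edge of the path `u v x y z` form 2K₂ + K₁ with the resting token
      -- `p`.
      no-straight₄ : ∀ {u v x y z p q} → Hop u v p q → Hop v x p q → x ≢ u →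
                     Hop x y p q → y ≢ v → Hop y z p q → z ≢ x → ⊥
      no-straight₄ m₀ m₁ x≢u m₂ y≢v m₃ z≢x = no-two-edges-and-vertex e₀ e₃
        (path₃ e₀ e₁ e₂ (≢-sym x≢u) (≢-sym y≢v))
        (path₄ e₀ e₁ e₂ e₃ (≢-sym x≢u) (≢-sym y≢v) (≢-sym z≢x))
        (path₂ e₁ e₂ (≢-sym y≢v)) (path₃ e₁ e₂ e₃ (≢-sym y≢v) (≢-sym z≢x))
        (Hop.u#p m₀) (Hop.v#p m₀) (Hop.u#p m₃) (Hop.v#p m₃)
        where
        e₀ = Hop.u~v m₀
        e₁ = Hop.u~v m₁
        e₂ = Hop.u~v m₂
        e₃ = Hop.u~v m₃

      -- The edges `u v` and `p p′` form 2K₂ + K₁ with `q`, since `u v x p′` is an induced path.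
      no-straight₃-follow : ∀ {u v x y p q p′} → Hop u v p q → Hop v x p q → x ≢ u →
                            Hop x y p q → Hop p p′ y q → p′ ~ x → ⊥
      no-straight₃-follow m₀ m₁ x≢u m₂ m₃ p′~x = no-two-edges-and-vertex (Hop.u~v m₀) (Hop.u~v m₃)
        (Hop.u#p m₀) (path₃ (Hop.u~v m₀) (Hop.u~v m₁) (~-sym p′~x) (≢-sym x≢u) v≢p′)
        (Hop.v#p m₀) (path₂ (Hop.u~v m₁) (~-sym p′~x) v≢p′)
        (Hop.u#q m₀) (Hop.v#q m₀) (Hop.p#q m₀) (Hop.v#q m₃)
        where v≢p′ = #⇒≢ (Hop.v#p m₀) (~-sym (Hop.u~v m₃))

    -- The centres are `v` with leaves `u`, `x` and `p′` with leaves `p`, `p″`; the resting token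
    -- `q` is the isolated vertex.
    no-two-turns : ¬ InducedEmbedding (D 2 2 2 ⊕ K 1) F → ∀ {u v x p q p′ p″} →
      Hop u v p q → Hop v x p q → x ≢ u → Hop p p′ x q → p′ ~ v → Hop p′ p″ x q → p″ ≢ p → ⊥
    no-two-turns no-D+K₁ {u} {v} {x} {p} {q} {p′} {p″} m₀ m₁ x≢u m₂ p′~v m₃ p″≢p = no-D+K₁
      (⊕-embedding
        (D-embedding
          (P-cons (singleton-embedding (P 1) p′) (~-sym p′~v) (λ { zero () }))
          (pair u x) (pair p p″)
          (pair-injective (≢-sym x≢u)) (pair-injective (≢-sym p″≢p))
          (λ { zero → Hop.u~v m₀ ; (suc zero) → ~-sym (Hop.u~v m₁) })
          (λ { zero → #⇒≢ (Hop.u#p m₀) (~-sym (Hop.u~v m₂)) ; (suc zero) → ≢-sym (proj₁ (Hop.v#p m₂)) })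
          (λ { zero → Hop.u~v m₂ ; (suc zero) → ~-sym (Hop.u~v m₃) })
          (λ { zero → ≢-sym (proj₁ (Hop.u#p m₁)) ; (suc zero) → #⇒≢ (Hop.v#p m₃) (Hop.u~v m₁) }))
        (singleton-embedding (K 1) q)
        (λ { (inj₁ (inj₁ zero))       _ → Hop.v#q m₀
           ; (inj₁ (inj₁ (suc zero))) _ → Hop.v#q m₂
           ; (inj₁ (inj₂ zero))       _ → Hop.u#q m₀
           ; (inj₁ (inj₂ (suc zero))) _ → Hop.v#q m₁
           ; (inj₂ zero)              _ → Hop.u#q m₂
           ; (inj₂ (suc zero))        _ → Hop.v#q m₃
           }))

    -- The tree is the path `v p′ p q′` with leaves `u`, `x` at `v` and `q`, `q″` at `q′`.
    no-turn-follow-turn : ¬ InducedEmbedding (D 2 4 2) F → ∀ {u v x p q p′ q′ q″} →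
      Hop u v p q → Hop v x p q → x ≢ u → Hop p p′ x q → p′ ~ v →
      Hop q q′ p′ x → q′ ~ p → Hop q′ q″ p′ x → q″ ≢ q → ⊥
    no-turn-follow-turn no-D {u} {v} {x} {p} {q} {p′} {q′} {q″} m₀ m₁ x≢u m₂ p′~v m₃ q′~p m₄ q″≢q = no-D
      (D-embedding
        (P-cons
          (P-cons
            (P-cons (singleton-embedding (P 1) q′) (~-sym q′~p) (λ { zero () }))
            (~-sym (Hop.u~v m₂)) (λ { (suc zero) _ → ≢-sym (proj₁ (Hop.v#p m₃)) }))
          (~-sym p′~v) (λ { (suc zero) _ → proj₁ (Hop.u#p m₁) }))
        (pair u x) (pair q q″)
        (pair-injective (≢-sym x≢u)) (pair-injective (≢-sym q″≢q))
        (λ { zero → Hop.u~v m₀ ; (suc zero) → ~-sym (Hop.u~v m₁) })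
        (λ { zero → #⇒≢ (Hop.u#p m₀) (~-sym (Hop.u~v m₂)) ; (suc zero) → ≢-sym (proj₁ (Hop.v#p m₂)) })
        (λ { zero → Hop.u~v m₃ ; (suc zero) → ~-sym (Hop.u~v m₄) })
        (λ { zero → ≢-sym (proj₁ (Hop.p#q m₀)) ; (suc zero) → #⇒≢ (Hop.v#p m₄) (Hop.u~v m₂) }))

    -- Walks in TS₃ without immediate return

    -- S indexes the positions of a walk w without end, σ s is the position after s.
    module _ (_~?_ : Decidable _~_)
      (no-2K₂+K₁ : ¬ InducedEmbedding (K 2 ⊕ K 2 ⊕ K 1) F)
      (no-D₂+K₁ : ¬ InducedEmbedding (D 2 2 2 ⊕ K 1) F)
      (no-D₄ : ¬ InducedEmbedding (D 2 4 2) F)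
      {S : Set} (σ : S → S) (w : S → IndependentSet F 3)
      (w-step : ∀ s → Graph._~_ (TS 3 F) (w s) (w (σ s))) (w-turn : ∀ s → w s ≢ w (σ (σ s)))
      where

      record Move (s : S) (u v p q : Fin n) : Set where
        field
          hop    : Hop u v p q
          before : value (w s) ≡ ⟪ u , p , q ⟫
          after  : value (w (σ s)) ≡ ⟪ v , p , q ⟫
        open Hop hop public
      open Move using (hop)

      move-swap : ∀ {s u v p q} → Move s u v p q → Move s u v q p
      move-swap {u = u} {v} {p} {q} m = record
        { hop    = hop-swap (hop m)
        ; before = trans (Move.before m) (⟪⟫-swap₂₃ u p q)
        ; after  = trans (Move.after m) (⟪⟫-swap₂₃ v p q)
        }

      move-token : ∀ s {u v p q} → value (w s) ≡ ⟪ u , p , q ⟫ → u # p → u # q → p # q →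
        value (w s) ─ value (w (σ s)) ≡ ⁅ u ⁆ → value (w (σ s)) ─ value (w s) ≡ ⁅ v ⁆ → u ~ v →
        Move s u v p q
      move-token s {u} {v} {p} {q} I≡ u#p u#q p#q I─J J─I u~v = record
        { hop = record { u~v = u~v ; u#p = u#p ; u#q = u#q ; v#p = apart zero ; v#q = apart (suc zero) ; p#q = p#q }
        ; before = I≡
        ; after = J≡
        }
        where
        I = value (w s)
        J = value (w (σ s))
        t = pair p q

        J≡ : J ≡ ⟪ v , p , q ⟫
        J≡ = slide-replaces {t = t} (λ { zero → proj₁ u#p ; (suc zero) → proj₁ u#q })
          (subst (λ I → I ─ J ≡ ⁅ u ⁆) I≡ I─J) (subst (λ I → J ─ I ≡ ⁅ v ⁆) I≡ J─I)

        ∈J : ∀ i → (v Fun.∷ t) i ∈ J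
        ∈J i = subst ((v Fun.∷ t) i ∈_) (sym J≡) (∈⟦⟧⁺ (v Fun.∷ t) i)

        v∉I : v ∉ I
        v∉I = x∈p─q⇒x∉q J I (subst (v ∈_) (sym J─I) (x∈⁅x⁆ v))

        -- `v` differs from the resting tokens because it is new in `J`, and is not adjacent to them
        -- because `J` is independent.
        apart : ∀ i → v # t i
        apart i = (λ v≡ → v∉I (subst₂ _∈_ (sym v≡) (sym I≡) (∈⟦⟧⁺ (u Fun.∷ t) (suc i))))
                      , TS-independent F (w (σ s)) (∈J zero) (∈J (suc i))

      -- After a follow, the token that moved just before is listed first among those at rest: a
      -- further `p-follows` moves it again, while `q-follows` brings in the remaining token.
      data Successor (s : S) (u v p q : Fin n) : Set where
        turns     : ∀ {x}  → x ≢ u  → Move (σ s) v x p q  → Successor s u v p q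
        p-follows : ∀ {p′} → p′ ~ u → Move (σ s) p p′ v q → Successor s u v p q
        q-follows : ∀ {q′} → q′ ~ u → Move (σ s) q q′ v p → Successor s u v p q

      move : ∀ s {u p q} → value (w s) ≡ ⟪ u , p , q ⟫ → u # p → u # q → p # q →
        ∃ (λ v → Move s u v p q) ⊎ ∃ (λ v → Move s p v u q) ⊎ ∃ (λ v → Move s q v u p)
      move s {u} {p} {q} I≡ u#p u#q p#q with a , b , I─J , J─I , a~b ← w-step s
        with ∈⟦⟧⁻ (triple u p q)
               (subst (a ∈_) I≡ (p─q⊆p (value (w s)) (value (w (σ s))) (subst (a ∈_) (sym I─J) (x∈⁅x⁆ a))))
      ... | zero         , refl = inj₁ (-, move-token s I≡ u#p u#q p#q I─J J─I a~b)
      ... | suc zero     , refl = inj₂ (inj₁ (-,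
        move-token s (trans I≡ (⟪⟫-swap₁₂ u p q)) (#-sym u#p) p#q u#q I─J J─I a~b))
      ... | suc (suc zero) , refl = inj₂ (inj₂ (-,
        move-token s (trans I≡ (trans (⟪⟫-swap₂₃ u p q) (⟪⟫-swap₁₂ u q p))) (#-sym u#q) (#-sym p#q) u#p I─J J─I a~b))

      successor : ∀ {s u v p q} → Move s u v p q → Successor s u v p q
      successor {s} {u} m with move (σ s) (Move.after m) (Move.v#p m) (Move.v#q m) (Move.p#q m)
      ... | inj₁ (x , m′) =
        -- A return to `u` would make `w s` and `w (σ (σ s))` the same set, against `w-turn`.
        turns (λ { refl → w-turn s (value-injective (trans (Move.before m) (sym (Move.after m′)))) }) m′
      ... | inj₂ (inj₁ (_ , m′)) = p-follows (follows no-2K₂+K₁ _~?_ (hop m) (hop m′)) m′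
      ... | inj₂ (inj₂ (_ , m′)) = q-follows (follows no-2K₂+K₁ _~?_ (hop (move-swap m)) (hop m′)) m′

      -- The walk has a fourth move, and both going straight on and being followed give 2K₂ + K₁.
      no-straight₃ : ∀ {s u v x y p q} → Move s u v p q → Move (σ s) v x p q → x ≢ u →
                     Move (σ (σ s)) x y p q → y ≢ v → ⊥
      no-straight₃ m₀ m₁ x≢u m₂ y≢v with successor m₂
      ... | turns z≢x m₃     = no-straight₄ no-2K₂+K₁ (hop m₀) (hop m₁) x≢u (hop m₂) y≢v (hop m₃) z≢x
      ... | p-follows p′~x m₃ = no-straight₃-follow no-2K₂+K₁ (hop m₀) (hop m₁) x≢u (hop m₂) (hop m₃) p′~x
      ... | q-follows q′~x m₃ = no-straight₃-follow no-2K₂+K₁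
        (hop (move-swap m₀)) (hop (move-swap m₁)) x≢u (hop (move-swap m₂)) (hop m₃) q′~x

      -- A third follow would close a cycle in the forest: of length 5 if the token at `p′` moves,
      -- of length 7 if the one at `v` does.
      turn-after-follows : ∀ {s u v p q p′ q′} → Move s u v p q → Move (σ s) p p′ v q → p′ ~ u →
        Move (σ (σ s)) q q′ p′ v → q′ ~ p → ∃ λ q″ → q″ ≢ q × Move (σ (σ (σ s))) q′ q″ p′ v
      turn-after-follows m₀ m₁ p′~u m₂ q′~p with successor m₂
      ... | turns q″≢q m₃   = -, q″≢q , m₃
      ... | p-follows x~q m₃ = ⊥-elim (no-return-after-follow (hop (move-swap m₁)) (hop m₂) q′~p (hop m₃) x~q)
      ... | q-follows x~q m₃ = ⊥-elim (no-return-after-follows (hop m₀) (hop m₁) p′~u (hop m₂) q′~p (hop m₃) x~q)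

      -- A turn next draws D₂,₂,₂ + K₁; a follow by the token at `x` closes a cycle; a follow by the
      -- one at `q` forces a turn after it, which draws D₂,₄,₂.
      no-turn-follow : ∀ {s u v x p q p′} → Move s u v p q → Move (σ s) v x p q → x ≢ u →
                       Move (σ (σ s)) p p′ x q → p′ ~ v → ⊥
      no-turn-follow m₀ m₁ x≢u m₂ p′~v with successor m₂
      ... | turns p″≢p m₃ = no-two-turns no-D₂+K₁ (hop m₀) (hop m₁) x≢u (hop m₂) p′~v (hop m₃) p″≢p
      ... | p-follows y~p m₃ = no-return-after-follow (hop m₁) (hop m₂) p′~v (hop m₃) y~p
      ... | q-follows q′~p m₃ with _ , q″≢q , m₄ ← turn-after-follows m₁ m₂ p′~v m₃ q′~p =
        no-turn-follow-turn no-D₄ (hop m₀) (hop m₁) x≢u (hop m₂) p′~v (hop m₃) q′~p (hop m₄) q″≢q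

      no-turn : ∀ {s u v x p q} → Move s u v p q → Move (σ s) v x p q → x ≢ u → ⊥
      no-turn m₀ m₁ x≢u with successor m₁
      ... | turns y≢v m₂      = no-straight₃ m₀ m₁ x≢u m₂ y≢v
      ... | p-follows p′~v m₂ = no-turn-follow m₀ m₁ x≢u m₂ p′~v
      ... | q-follows q′~v m₂ = no-turn-follow (move-swap m₀) (move-swap m₁) x≢u m₂ q′~v

      -- The next move closes a cycle, is a turn, or forces a turn after it; `no-turn` excludes the
      -- turns.
      no-follow : ∀ {s u v p q p′} → Move s u v p q → Move (σ s) p p′ v q → p′ ~ u → ⊥
      no-follow m₀ m₁ p′~u with successor m₁
      ... | turns p″≢p m₂ = no-turn m₁ m₂ p″≢p
      ... | p-follows x~p m₂ = no-return-after-follow (hop m₀) (hop m₁) p′~u (hop m₂) x~p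
      ... | q-follows q′~p m₂ with _ , q″≢q , m₃ ← turn-after-follows m₀ m₁ p′~u m₂ q′~p = no-turn m₂ m₃ q″≢q

      no-move : ∀ {s u v p q} → ¬ Move s u v p q
      no-move m with successor m
      ... | turns x≢u m′      = no-turn m m′ x≢u
      ... | p-follows p′~u m′ = no-follow m m′ p′~u
      ... | q-follows q′~u m′ = no-follow (move-swap m) m′ q′~u

      no-walk : ¬ S
      no-walk s with t , t-inj , I≡ ← enumerate (value (w s)) (TS-size F (w s)) =
        [ no-move ∘ proj₂ , [ no-move ∘ proj₂ , no-move ∘ proj₂ ] ]
          (move s I≡ (apart zero (suc zero) λ ()) (apart zero (suc (suc zero)) λ ())
            (apart (suc zero) (suc (suc zero)) λ ()))
        where
        apart : ∀ i j → i ≢ j → t i # t j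
        apart i j i≢j = i≢j ∘ t-inj ,
          TS-independent F (w s) (subst (t i ∈_) (sym I≡) (∈⟦⟧⁺ t i)) (subst (t j ∈_) (sym I≡) (∈⟦⟧⁺ t j))

-- Cycles

-- The cyclic successor, under which `step` and `close` of a `Cycle` become one condition.
rotation : Fin (suc k) → Fin (suc k)
rotation i with view i
... | ‵fromℕ     = zero
... | ‵inject₁ j = suc j

rotation-fromℕ : ∀ k → rotation (fromℕ k) ≡ zero
rotation-fromℕ k rewrite view-fromℕ k = refl

rotation-inject₁ : (i : Fin k) → rotation (inject₁ i) ≡ suc i
rotation-inject₁ i rewrite view-inject₁ i = refl

-- Supplies `w-turn` for a cycle: on at least three positions, two steps do not lead back.
rotation² : (i : Fin (3 + k)) → i ≢ rotation (rotation i)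
rotation² {k} i with view i
... | ‵fromℕ     = λ ()
... | ‵inject₁ j with view j
...   | ‵fromℕ     = λ ()
-- Without wrapping around, two steps raise `toℕ` by two, which is the `1+n` of the inequality at
-- `n = 1`.
...   | ‵inject₁ j = λ eq → ℕ.m≢1+n+m (toℕ j) {1} (trans (sym (trans (toℕ-inject₁ _) (toℕ-inject₁ _))) (cong toℕ eq))

module _ {V : Set} {G : Graph V} (cycle : Cycle G) where
  open Cycle cycle

  cycle-step : ∀ i → Graph._~_ G (vertex i) (vertex (rotation i))
  cycle-step i with view i
  ... | ‵fromℕ     = close
  ... | ‵inject₁ j = step j

-- Excluded middle for one pair of vertices is irrefutable, and finitely many irrefutable statements
-- are jointly irrefutable.
¬¬-decidable : (G : Graph (Fin n)) → ¬ ¬ Decidable (Graph._~_ G)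
¬¬-decidable G = sequence applicative λ _ → sequence applicative λ _ → ¬¬-excluded-middle
  where applicative = RawMonad.rawApplicative ¬¬-Monad

-- Tours of tokens in the forbidden graphs

K? : ∀ n → Decidable (Graph._~_ (K n))
K? n i j = ¬? (i ≟ j)

P? : ∀ n → Decidable (Graph._~_ (P n))
P? n i j = map′ [ fwd , bwd ] (λ { (fwd e) → inj₁ e ; (bwd e) → inj₂ e }) (next? i j ⊎-dec next? j i)
  where
  next? : (i j : Fin n) → Dec (Next i j)
  next? i j = map′ (toℕ⇒Next i j) Next⇒toℕ (suc (toℕ i) ℕ.≟ toℕ j)

attachLeaves? : (G : Graph V) (v : V) (r : ℕ) → DecidableEquality V →
  Decidable (Graph._~_ G) → Decidable (Graph._~_ (attachLeaves G v r))
attachLeaves? G v r _≟V_ _~?_ (inj₁ x) (inj₁ y) = x ~? y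
attachLeaves? G v r _≟V_ _~?_ (inj₁ x) (inj₂ _) = x ≟V v
attachLeaves? G v r _≟V_ _~?_ (inj₂ _) (inj₁ y) = y ≟V v
attachLeaves? G v r _≟V_ _~?_ (inj₂ _) (inj₂ _) = no λ ()

D? : ∀ r m s → Decidable (Graph._~_ (D (suc r) (suc m) (suc s)))
D? r m s = attachLeaves? _ _ _ (⊎-≡-dec _≟_ _≟_) (attachLeaves? _ _ _ _≟_ (P? (suc m)))

module _ {W : Set} (H : Graph W) where
  open Graph H

  -- The last condition says that the configurations differ as unlabelled sets.
  Tour : (Fin (suc l) → Vector W k) → Set
  Tour t =
    (∀ i a b → a ≢ b → t i a ≢ t i b × ¬ t i a ~ t i b) ×
    (∀ i → ∃ λ a → t i a ~ t (rotation i) a × ∀ b → b ≢ a → t i b ≡ t (rotation i) b) ×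
    (∀ i j → (∀ a → ∃ λ b → t i a ≡ t j b) → i ≡ j)

  -- Reduces the check of an explicit tour to evaluation.
  tour? : DecidableEquality W → Decidable _~_ → (t : Fin (suc l) → Vector W k) → Dec (Tour t)
  tour? _≟W_ _~?_ t =
    all? (λ i → all? λ a → all? λ b → ¬? (a ≟ b) →-dec (¬? (t i a ≟W t i b) ×-dec ¬? (t i a ~? t i b))) ×-dec
    all? (λ i → any? λ a → (t i a ~? t (rotation i) a) ×-dec
          all? λ b → ¬? (b ≟ a) →-dec (t i b ≟W t (rotation i) b)) ×-dec
    all? (λ i → all? λ j → all? (λ a → any? λ b → t i a ≟W t j b) →-dec (i ≟ j))

module _ {W : Set} {H : Graph W} {F : Graph (Fin n)} (f : InducedEmbedding H F) where
  private module H = Graph H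
  open Graph F
  open InducedEmbedding f

  slide : (t t′ : Vector W k) → (∀ a b → a ≢ b → t a ≢ t b) →
    ∀ a → t a H.~ t′ a → (∀ b → b ≢ a → t b ≡ t′ b) → ⟦ map ∘ t ⟧ ─ ⟦ map ∘ t′ ⟧ ≡ ⁅ map (t a) ⁆
  slide t t′ distinct a ta~t′a rest = ⊆-antisym I─J⊆ ⊆I─J
    where
    I = ⟦ map ∘ t ⟧
    J = ⟦ map ∘ t′ ⟧

    I─J⊆ : I ─ J ⊆ ⁅ map (t a) ⁆
    I─J⊆ x∈ with b , refl ← ∈⟦⟧⁻ (map ∘ t) (p─q⊆p I J x∈) with b ≟ a
    ... | yes refl = x∈⁅x⁆ _
    ... | no  b≢a  = contradiction (subst (λ x → map x ∈ J) (sym (rest b b≢a)) (∈⟦⟧⁺ (map ∘ t′) b)) (x∈p─q⇒x∉q I J x∈)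

    ta∉J : map (t a) ∉ J
    ta∉J ∈J with b , eq ← ∈⟦⟧⁻ (map ∘ t′) ∈J with b ≟ a
    ... | yes refl = H.~-irrefl (injective eq) ta~t′a
    ... | no  b≢a  = distinct a b (≢-sym b≢a) (trans (injective eq) (sym (rest b b≢a)))

    ⊆I─J : ⁅ map (t a) ⁆ ⊆ I ─ J
    ⊆I─J x∈ with refl ← x∈⁅y⁆⇒x≡y _ x∈ = x∈p∧x∉q⇒x∈p─q (∈⟦⟧⁺ (map ∘ t) a) ta∉J

  tour-cycle : .{{_ : NonTrivial k}} (t : Fin (3 + l) → Vector W k) → Tour H t → Cycle (TS k F)
  tour-cycle {k} t (independent , slides , distinct) = record
    { vertex   = vertex
    -- Equal sets have the same tokens up to order, which the last condition of `Tour` allows only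
    -- at equal positions.
    ; distinct = λ {i} {j} eq → distinct i j λ a →
        let b , eq′ = ∈⟦⟧⁻ (map ∘ t j) (subst (map (t i a) ∈_) (cong value eq) (∈⟦⟧⁺ (map ∘ t i) a))
        in b , injective eq′
    ; step     = λ i →
        subst (λ j → Graph._~_ (TS k F) (vertex (inject₁ i)) (vertex j)) (rotation-inject₁ i) (step (inject₁ i))
    ; close    = subst (λ j → Graph._~_ (TS k F) (vertex (fromℕ _)) (vertex j)) (rotation-fromℕ _) (step (fromℕ _))
    }
    where
    tᵢ-injective : ∀ i {a b} → map (t i a) ≡ map (t i b) → a ≡ b
    tᵢ-injective i {a} {b} eq = decidable-stable (a ≟ b) λ a≢b → proj₁ (independent i a b a≢b) (injective eq)

    t-independent : ∀ i → Independent F ⟦ map ∘ t i ⟧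
    t-independent i u∈ v∈ u~v with a , refl ← ∈⟦⟧⁻ (map ∘ t i) u∈ | b , refl ← ∈⟦⟧⁻ (map ∘ t i) v∈ with a ≟ b
    ... | yes refl = ~-irrefl refl u~v
    ... | no  a≢b  = proj₂ (independent i a b a≢b) (from (adjacency _ _) u~v)

    vertex : Fin _ → IndependentSet F k
    vertex i = ⟦ map ∘ t i ⟧ ⊣ ⟨ ∣⟦⟧∣ (map ∘ t i) (tᵢ-injective i) , t-independent i ⟩

    step : ∀ i → Graph._~_ (TS k F) (vertex i) (vertex (rotation i))
    step i with a , ta~t′a , rest ← slides i = map (t i a) , map (t (rotation i) a)
      , slide _ _ (λ a b a≢b → proj₁ (independent i a b a≢b)) a ta~t′a rest
      , slide _ _ (λ a b a≢b → proj₁ (independent (rotation i) a b a≢b)) a (H.~-sym ta~t′a) (λ b b≢a → sym (rest b b≢a))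
      , to (adjacency _ _) ta~t′a

-- Two tokens alternately cross their own edges while the third stays on the isolated vertex: a
-- 4-cycle.
2K₂+K₁-tour : ∃ (Tour (K 2 ⊕ K 2 ⊕ K 1) {3} {3})
2K₂+K₁-tour = t , from-yes (tour? (K 2 ⊕ K 2 ⊕ K 1) (⊎-≡-dec (⊎-≡-dec _≟_ _≟_) _≟_)
                             (⊎-decidable (⊎-decidable (K? 2) (K? 2)) (K? 1)) t)
  where
  x y : Fin 2 → (Fin 2 ⊎ Fin 2) ⊎ Fin 1
  x i = inj₁ (inj₁ i)
  y i = inj₁ (inj₂ i)

  t = lookup (
    triple (x zero) (y zero) (inj₂ zero) ∷
    triple (x (suc zero)) (y zero) (inj₂ zero) ∷
    triple (x (suc zero)) (y (suc zero)) (inj₂ zero) ∷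
    triple (x zero) (y (suc zero)) (inj₂ zero) ∷ [])

-- Each of two tokens changes leaves through its own centre while the other rests on a leaf, since
-- the centres are adjacent: an 8-cycle.
D₂+K₁-tour : ∃ (Tour (D 2 2 2 ⊕ K 1) {7} {3})
D₂+K₁-tour = t , from-yes (tour? (D 2 2 2 ⊕ K 1) (⊎-≡-dec (⊎-≡-dec (⊎-≡-dec _≟_ _≟_) _≟_) _≟_)
                           (⊎-decidable (D? 1 1 1) (K? 1)) t)
  where
  V′ = ((Fin 2 ⊎ Fin 2) ⊎ Fin 2) ⊎ Fin 1

  a b a₁ a₂ b₁ b₂ : V′
  a  = inj₁ (inj₁ (inj₁ zero))
  b  = inj₁ (inj₁ (inj₁ (suc zero)))
  a₁ = inj₁ (inj₁ (inj₂ zero))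
  a₂ = inj₁ (inj₁ (inj₂ (suc zero)))
  b₁ = inj₁ (inj₂ zero)
  b₂ = inj₁ (inj₂ (suc zero))

  t = lookup (
    triple a b₁ (inj₂ zero) ∷
    triple a₁ b₁ (inj₂ zero) ∷
    triple a₁ b (inj₂ zero) ∷
    triple a₁ b₂ (inj₂ zero) ∷
    triple a b₂ (inj₂ zero) ∷
    triple a₂ b₂ (inj₂ zero) ∷
    triple a₂ b (inj₂ zero) ∷
    triple a₂ b₁ (inj₂ zero) ∷ [])

-- The outer tokens change leaves in turn. The middle one stands on `c` while the first is at `a`,
-- and on `b` while the last is at `d`: a 12-cycle.
D₄-tour : ∃ (Tour (D 2 4 2) {11} {3})
D₄-tour = t , from-yes (tour? (D 2 4 2) (⊎-≡-dec (⊎-≡-dec _≟_ _≟_) _≟_) (D? 1 3 1) t)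
  where
  V′ = (Fin 4 ⊎ Fin 2) ⊎ Fin 2

  a b c d a₁ a₂ d₁ d₂ : V′
  a  = inj₁ (inj₁ zero)
  b  = inj₁ (inj₁ (suc zero))
  c  = inj₁ (inj₁ (suc (suc zero)))
  d  = inj₁ (inj₁ (suc (suc (suc zero))))
  a₁ = inj₁ (inj₂ zero)
  a₂ = inj₁ (inj₂ (suc zero))
  d₁ = inj₂ zero
  d₂ = inj₂ (suc zero)

  t = lookup (
    triple a c d₁ ∷
    triple a₁ c d₁ ∷
    triple a₁ b d₁ ∷
    triple a₁ b d ∷
    triple a₁ b d₂ ∷
    triple a₁ c d₂ ∷
    triple a c d₂ ∷
    triple a₂ c d₂ ∷
    triple a₂ b d₂ ∷
    triple a₂ b d ∷
    triple a₂ b d₁ ∷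
    triple a₂ c d₁ ∷ [])

corollary7 : (n : ℕ) (F : Graph (Fin n)) → Forest F →
    Forest (TS 3 F) ⇔
    Free ((-, K 2 ⊕ K 2 ⊕ K 1) ∷ (-, D 2 2 2 ⊕ K 1) ∷ (-, D 2 4 2) ∷ []) F
corollary7 n F forest = mk⇔
  (λ TS-forest →
    (λ f → TS-forest (tour-cycle f (proj₁ 2K₂+K₁-tour) (proj₂ 2K₂+K₁-tour))) ∷
    (λ f → TS-forest (tour-cycle f (proj₁ D₂+K₁-tour) (proj₂ D₂+K₁-tour))) ∷
    (λ f → TS-forest (tour-cycle f (proj₁ D₄-tour) (proj₂ D₄-tour))) ∷ [])
  -- The goal is a contradiction, so adjacency may be taken to be decidable. The cycle, run around
  -- endlessly by `rotation`, is the walk to be refuted.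
  (λ { (no-2K₂+K₁ ∷ no-D₂+K₁ ∷ no-D₄ ∷ []) cycle → ¬¬-decidable F λ _~?_ →
    no-walk F forest _~?_ no-2K₂+K₁ no-D₂+K₁ no-D₄ rotation (Cycle.vertex cycle) (cycle-step cycle)
      (λ i eq → rotation² i (Cycle.distinct cycle eq)) zero })
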